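{- Let $G$ and $H$ be graphs and let $R\subseteq V_G\times V_H$ be a relation with $G\ast R=H$. Then there is a set $B$, an injective relation $R_D\subseteq \operatorname{dom}R\times B$ with full domain, and a surjective relation $R_C\subseteq B\times \operatorname{img}R$ such that $$(G[\operatorname{dom}R]\ast R_D)\ast R_C=H .$$
   Context: Graphs are finite and undirected, with loops allowed: $G=(V_G,E_G)$ with $E_G\subseteq V_G\times V_G$ symmetric. For a relation $R\subseteq X\times Y$: $\operatorname{dom}R=\{x\in X: \exists p\in Y,\ (x,p)\in R\}$ and $\operatorname{img}R=\{p\in Y:\exists x\in X,\ (x,p)\in R\}$; $R$ has full domain if $\operatorname{dom}R=X$ and full image if $\operatorname{img}R=Y$; $R$ is injective if $(x,y),(z,y)\in R$ implies $x=z$; $R$ is surjective if it has full image. For a graph $G$, a finite set $B$ and a relation $R\subseteq V_G\times B$ with full image, $G\ast R$ is the graph with vertex set $B$ and edge set $\{(u,v)\in B\times B : \text{there is } (x,y)\in E_G \text{ with } (x,u),(y,v)\in R\}$. Writing $G\ast R$ presupposes that the target set is finite and $R$ has full image; $G\ast R=H$ means equality of graphs (in particular $B=V_H$). $G[W]$ denotes the subgraph of $G$ induced by $W\subseteq V_G$. -}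

module Defs where

open import Data.List.Membership.Propositional using () renaming (_∈_ to _∈ₗ_)
open import Data.Product using (∃-syntax; _×_; _,_; proj₁; proj₂)
open import Function using (_∘_)
open import Level using (0ℓ)
open import Relation.Binary.Core using (REL; Rel; _⇔_)
open import Relation.Binary.Definitions using (Symmetric)
open import Relation.Binary.PropositionalEquality using (_≡_)
open import Relation.Unary using (Pred; _∈_; _⊆_; _≐_)

-- Sets are subsets of an arbitrary ambient type, so that dom R, img R and
-- the vertex set of an induced subgraph are again sets of the same kind and
-- equality of graphs can be stated literally (extensionally).

-- Finiteness is containment in a list. Classically this is the usual notion;
-- constructively it keeps finiteness closed under arbitrary subsets, so that
-- no decidability has to be assumed of edges or relations.
Finite : {A : Set} → Pred A 0ℓ → Set
Finite {A} P = ∃[ xs ] (∀ {x : A} → x ∈ P → x ∈ₗ xs)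

record FinSet (A : Set) : Set₁ where
  field
    ⟦_⟧    : Pred A 0ℓ
    finite : Finite ⟦_⟧

open FinSet public using (⟦_⟧)

record Graph (A : Set) : Set₁ where
  field
    V     : FinSet A
    E     : Rel A 0ℓ
    E⊆V×V : ∀ {x y} → E x y → x ∈ ⟦ V ⟧ × y ∈ ⟦ V ⟧
    E-sym : Symmetric E

open Graph public using (V; E)

infix 4 _≈_
_≈_ : {A : Set} → Graph A → Graph A → Set
G ≈ H = ⟦ V G ⟧ ≐ ⟦ V H ⟧ × E G ⇔ E H

record Relation {A B : Set} (X : FinSet A) (Y : FinSet B) : Set₁ where
  field
    rel     : REL A B 0ℓ
    rel⊆X×Y : ∀ {x y} → rel x y → x ∈ ⟦ X ⟧ × y ∈ ⟦ Y ⟧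

open Relation public using (rel)

module _ {A B : Set} {X : FinSet A} {Y : FinSet B} (R : Relation X Y) where
  open Relation R using (rel⊆X×Y)

  dom : FinSet A
  dom = record
    { ⟦_⟧    = λ x → x ∈ ⟦ X ⟧ × (∃[ p ] p ∈ ⟦ Y ⟧ × rel R x p)
    ; finite = proj₁ (FinSet.finite X) , proj₂ (FinSet.finite X) ∘ proj₁
    }

  img : FinSet B
  img = record
    { ⟦_⟧    = λ p → p ∈ ⟦ Y ⟧ × (∃[ x ] x ∈ ⟦ X ⟧ × rel R x p)
    ; finite = proj₁ (FinSet.finite Y) , proj₂ (FinSet.finite Y) ∘ proj₁
    }

  dom⊆X : ⟦ dom ⟧ ⊆ ⟦ X ⟧
  dom⊆X = proj₁

  FullDomain : Set
  FullDomain = ⟦ dom ⟧ ≐ ⟦ X ⟧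

  FullImage : Set
  FullImage = ⟦ img ⟧ ≐ ⟦ Y ⟧

  Injective : Set
  Injective = ∀ {x y z} → rel R x y → rel R z y → x ≡ z

  Surjective : Set
  Surjective = FullImage

-- The last argument is the precondition under which G ∗ R is defined.
infix 6 _∗_⟨_⟩
_∗_⟨_⟩ : {A B : Set} {Y : FinSet B} (G : Graph A) (R : Relation (V G) Y) →
         FullImage R → Graph B
_∗_⟨_⟩ {Y = Y} G R _ = record
  { V     = Y
  ; E     = λ u v → ∃[ x ] ∃[ y ] (E G x y × rel R x u × rel R y v)
  ; E⊆V×V = λ (_ , _ , _ , xRu , yRv) →
              proj₂ (Relation.rel⊆X×Y R xRu) , proj₂ (Relation.rel⊆X×Y R yRv)
  ; E-sym = λ (x , y , e , xRu , yRv) → y , x , Graph.E-sym G e , yRv , xRu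
  }

infix 7 _[_∣_]
_[_∣_] : {A : Set} (G : Graph A) (W : FinSet A) → ⟦ W ⟧ ⊆ ⟦ V G ⟧ → Graph A
G [ W ∣ _ ] = record
  { V     = W
  ; E     = λ x y → E G x y × x ∈ ⟦ W ⟧ × y ∈ ⟦ W ⟧
  ; E⊆V×V = proj₂
  ; E-sym = λ (e , x∈W , y∈W) → Graph.E-sym G e , y∈W , x∈W
  }

{-# OPTIONS --safe #-}

-- Take B to be R itself, as a set of pairs: R_D sends x to every pair (x , p)
-- of R, and R_C projects (x , p) to p. Then R_C after R_D is R.
module Submission where

open import Data.List.Base using (cartesianProduct)
open import Data.List.Membership.Propositional.Properties using (∈-cartesianProduct⁺)
open import Data.Product using (Σ-syntax; _×_; _,_; proj₁; proj₂; uncurry)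
open import Relation.Binary.PropositionalEquality using (_≡_; refl)
open import Defs

-- An edge of `G ∗ R` between u and v comes from an edge of `G` between some x and y with x R u and
-- y R v. Routing it through the pairs (x , u) and (y , v) splits `R` in two: a pair remembers its
-- first coordinate, so `duplication` is injective, and forgetting that coordinate is `contraction`.
-- Such x and y lie in `dom R`, so passing to the induced subgraph loses none of these edges.

module _ {A C : Set} {X : FinSet A} {Y : FinSet C} (R : Relation X Y) where
  open Relation R using (rel⊆X×Y)

  graphOf : FinSet (A × C)
  graphOf = record
    { ⟦_⟧    = uncurry (rel R)
    ; finite = let xs , X⊆xs = FinSet.finite X
                   ys , Y⊆ys = FinSet.finite Y
               in cartesianProduct xs ys , λ r → let x∈X , p∈Y = rel⊆X×Y r in
                  ∈-cartesianProduct⁺ (X⊆xs x∈X) (Y⊆ys p∈Y)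
    }

  rel⊆dom×img : ∀ {x p} → rel R x p → ⟦ dom R ⟧ x × ⟦ img R ⟧ p
  rel⊆dom×img {x} {p} r = let x∈X , p∈Y = rel⊆X×Y r in
    (x∈X , p , p∈Y , r) , (p∈Y , x , x∈X , r)

  -- Since `b` ranges over all of `A × C`, the first conjunct is there to force `b` into `graphOf`,
  -- once `x ≡ proj₁ b`.
  duplication : Relation (dom R) graphOf
  duplication = record
    { rel     = λ x b → rel R x (proj₂ b) × x ≡ proj₁ b
    ; rel⊆X×Y = λ { (r , refl) → proj₁ (rel⊆dom×img r) , r }
    }

  contraction : Relation graphOf (img R)
  contraction = record
    { rel     = λ b p → rel R (proj₁ b) p × proj₂ b ≡ p
    ; rel⊆X×Y = λ { (r , refl) → r , proj₂ (rel⊆dom×img r) }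
    }

  duplication-injective : Injective duplication
  duplication-injective (_ , refl) (_ , refl) = refl

  duplication-fullDomain : FullDomain duplication
  duplication-fullDomain =
    proj₁ , λ { {x} x∈dom@(_ , p , _ , r) → x∈dom , (x , p) , r , r , refl }

  duplication-fullImage : FullImage duplication
  duplication-fullImage =
    proj₁ , λ { {x , _} r → r , x , proj₁ (rel⊆dom×img r) , r , refl }

  contraction-surjective : Surjective contraction
  contraction-surjective =
    proj₁ , λ { {p} p∈img@(_ , x , _ , r) → p∈img , (x , p) , r , r , refl }

corollary2p3 : {A C : Set} (G : Graph A) (H : Graph C) (R : Relation (V G) (V H))
    (R-full : FullImage R) → G ∗ R ⟨ R-full ⟩ ≈ H →
    Σ[ U ∈ Set ] Σ[ B ∈ FinSet U ]
    Σ[ R-D ∈ Relation (dom R) B ] Σ[ R-C ∈ Relation B (img R) ]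
    Injective R-D × FullDomain R-D ×
    (Σ[ D-full ∈ FullImage R-D ] Σ[ C-surj ∈ Surjective R-C ]
    (G [ dom R ∣ dom⊆X R ] ∗ R-D ⟨ D-full ⟩) ∗ R-C ⟨ C-surj ⟩ ≈ H)
corollary2p3 {A} {C} G H R R-full (_ , E⇒ , E⇐) =
  (A × C) , graphOf R , duplication R , contraction R ,
  duplication-injective R , duplication-fullDomain R ,
  duplication-fullImage R , contraction-surjective R ,
  -- The final vertex set is `img R`, so equality of vertex sets is exactly `R-full`.
  R-full , to , from
  where
  G′ : Graph C
  G′ = (G [ dom R ∣ dom⊆X R ] ∗ duplication R ⟨ duplication-fullImage R ⟩)
         ∗ contraction R ⟨ contraction-surjective R ⟩

  to : ∀ {u v} → E G′ u v → E H u v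
  -- The equalities force the intermediate vertices to be (x , u) and (y , v).
  to (_ , _ , (x , y , (e , _) , (r , refl) , (s , refl)) , (_ , refl) , (_ , refl)) =
    E⇒ (x , y , e , r , s)

  from : ∀ {u v} → E H u v → E G′ u v
  from {u} {v} h = let x , y , e , r , s = E⇐ h in
    (x , u) , (y , v) ,
    (x , y , (e , proj₁ (rel⊆dom×img R r) , proj₁ (rel⊆dom×img R s)) ,
     (r , refl) , (s , refl)) ,
    (r , refl) , (s , refl)
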